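{- If $A\subseteq\omega$ is infinite and computably enumerable, there is a computable permutation $\pi:\omega\to\omega$ such that $\pi(A)$ has density $1$.
   Context: For $S\subseteq\omega$, $\rho_n(S)=|S\cap[0,n)|/n$; $S$ has density $d$ if $\lim_{n\to\infty}\rho_n(S)=d$. -}

module Defs where

open import Data.Nat using (ℕ; suc; _*_; _≤_; _<_)
open import Data.Maybe using (Maybe; just)
open import Data.List using (List; length)
open import Data.List.Relation.Unary.All using (All)
open import Data.List.Relation.Unary.Unique.Propositional using (Unique)
open import Data.Product using (Σ; ∃; _×_)
open import Function.Bundles using (_⇔_)
open import Relation.Binary.PropositionalEquality using (_≡_)

Subset : Set₁
Subset = ℕ → Set

-- A is computably enumerable: there is an enumeration e (stage m either
-- enumerates nothing or some number) whose enumerated values are exactly A.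
-- (Agda functions ℕ → Maybe ℕ are computable.)
IsCE : Subset → Set
IsCE A = Σ (ℕ → Maybe ℕ) λ e → ∀ k → A k ⇔ (∃ λ m → e m ≡ just k)

Infinite : Subset → Set
Infinite A = ∀ n → ∃ λ k → n ≤ k × A k

Image : (ℕ → ℕ) → Subset → Subset
Image f S k = ∃ λ a → S a × f a ≡ k

-- ρ_n(S) ≥ k/(k+1), expressed without division/counting: there is a list of
-- distinct elements of S ∩ [0,n) of length L with k·n ≤ (k+1)·L.
DensityAtLeast : Subset → ℕ → ℕ → Set
DensityAtLeast S k n =
  Σ (List ℕ) λ L → Unique L × All (λ x → x < n × S x) L × k * n ≤ suc k * length L

-- S has density 1: lim ρ_n(S) = 1.  Since ρ_n ≤ 1 always, this is
-- ∀ ε = 1/(k+1) > 0, ∃ N, ∀ n ≥ N, ρ_n(S) ≥ 1 - 1/(k+1).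
HasDensityOne : Subset → Set
HasDensityOne S = ∀ k → ∃ λ N → ∀ n → N ≤ n → DensityAtLeast S k n

module Submission where

-- Fix a Boolean predicate z on ℕ that is infinite,
-- co-infinite and of density 0 (here: "n + 1 is a perfect square").
-- (1) A infinite gives, constructively, an increasing sequence in A with
--     gaps; its range is a decidable set B ⊆ A which is infinite and
--     co-infinite.  (This is the role the c.e. hypothesis plays in the
--     paper: an infinite c.e. set has an infinite computable subset.  Here
--     the constructive reading of Infinite A already provides it.)
-- (2) For every decidable p with p and ¬p both infinite, counting (rank)
--     and selecting the i-th element (select) give a bijection
--     ℕ ↔ ℕ ⊎ ℕ sending the points of p to the left summand.
-- (3) Composing the bijections for B and for z (swapping the summands)
--     yields a permutation π with π(B) = ℕ ∖ z, so ℕ ∖ z ⊆ π(A).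
-- (4) ℕ ∖ z has density 1 because z has density 0, and density 1 is
--     inherited by supersets.

open import Defs
open import Data.Bool using (Bool; true; false; T; not; if_then_else_)
open import Data.Empty using (⊥-elim)
open import Data.Bool.ListAction using (any)
open import Data.List using (List; []; _∷_; length; upTo)
open import Data.List.Membership.Propositional using (lose)
open import Data.List.Membership.Propositional.Properties using (∈-upTo⁺)
open import Data.List.Relation.Unary.All as All using (All; []; _∷_)
open import Data.List.Relation.Unary.AllPairs using ([]; _∷_)
open import Data.List.Relation.Unary.Any using (satisfied)
open import Data.List.Relation.Unary.Any.Properties using (any⁺; any⁻)
open import Data.List.Relation.Unary.Unique.Propositional using (Unique)
open import Data.Nat using (ℕ; zero; suc; _+_; _*_; _∸_; _≤_; _<_; _≤′_; z≤n; s≤s; _≡ᵇ_; _≤ᵇ_; _≤?_)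
open import Data.Nat.Properties
open import Data.Product using (Σ; ∃; _×_; _,_; proj₁; proj₂; map₁; map₂)
open import Data.Sum using (_⊎_; inj₁; inj₂; [_,_]; swap)
open import Data.Sum.Algebra using (⊎-comm)
open import Function using (_∘_)
open import Function.Bundles using (_↔_; Inverse; mk↔ₛ′)
open import Function.Properties.Inverse using (↔-sym; ↔-trans)
open import Relation.Binary.Definitions using (tri<; tri≈; tri>)
open import Relation.Binary.PropositionalEquality hiding ([_])
open import Relation.Nullary using (yes; no)

Unbounded : (ℕ → Bool) → Set
Unbounded p = ∀ n → ∃ λ k → n ≤ k × T (p k)

monotone-by-steps : (f : ℕ → ℕ) → (∀ n → f n ≤ f (suc n)) → ∀ {m n} → m ≤ n → f m ≤ f n
monotone-by-steps f step m≤n = go (≤⇒≤′ m≤n)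
  where
  go : ∀ {m n} → m ≤′ n → f m ≤ f n
  go (_≤′_.≤′-reflexive refl) = ≤-refl
  go (_≤′_.≤′-step m≤′n) = ≤-trans (go m≤′n) (step _)

members : (ℕ → Bool) → ℕ → List ℕ
members p zero = []
members p (suc n) = if p n then n ∷ members p n else members p n

count : (ℕ → Bool) → ℕ → ℕ
count p n = length (members p n)

members-below : ∀ p n → All (λ x → x < n × T (p x)) (members p n)
members-below p zero = []
members-below p (suc n) with p n in eq
... | true  = (n<1+n n , subst T (sym eq) _) ∷ All.map (map₁ m<n⇒m<1+n) (members-below p n)
... | false = All.map (map₁ m<n⇒m<1+n) (members-below p n)

members-unique : ∀ p n → Unique (members p n)
members-unique p zero = []
members-unique p (suc n) with p n
... | true  = All.map (λ { (x<n , _) n≡x → <-irrefl (sym n≡x) x<n }) (members-below p n) ∷ members-unique p n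
... | false = members-unique p n

count-sat : ∀ p x → T (p x) → count p (suc x) ≡ suc (count p x)
count-sat p x px with p x
... | true = refl

count-unsat : ∀ p x → p x ≡ false → count p (suc x) ≡ count p x
count-unsat p x eq rewrite eq = refl

count-step : ∀ p n → count p n ≤ count p (suc n)
count-step p n with p n
... | true  = n≤1+n _
... | false = ≤-refl

count-complement : ∀ p n → count p n + count (not ∘ p) n ≡ n
count-complement p zero = refl
count-complement p (suc n) with p n
... | true  = cong suc (count-complement p n)
... | false = trans (+-suc _ _) (cong suc (count-complement p n))

count-strict : ∀ p {x y} → T (p x) → x < y → count p x < count p y
count-strict p {x} px x<y =
  subst (_≤ _) (count-sat p x px) (monotone-by-steps (count p) (count-step p) x<y)

count-injective : ∀ p {x y} → T (p x) → T (p y) → count p x ≡ count p y → x ≡ y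
count-injective p {x} {y} px py eq with <-cmp x y
... | tri< x<y _ _ = ⊥-elim (<-irrefl eq (count-strict p px x<y))
... | tri≈ _ x≡y _ = x≡y
... | tri> _ _ y<x = ⊥-elim (<-irrefl (sym eq) (count-strict p py y<x))

module Select (p : ℕ → Bool) (unbounded : Unbounded p) where

  search : ℕ → ℕ → ℕ
  search n zero = n
  search n (suc f) = if p n then n else search (suc n) f

  -- If p holds at n+f, the search finds a point of p without passing
  -- any other point, so the rank does not change.
  search-spec : ∀ f n → T (p (f + n)) → T (p (search n f)) × count p (search n f) ≡ count p n
  search-spec zero n pn = pn , refl
  search-spec (suc f) n pf+n with p n in eq
  ... | true  = subst T (sym eq) _ , refl
  ... | false with search-spec f (suc n) (subst (T ∘ p) (sym (+-suc f n)) pf+n)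
  ...   | found , rank = found , trans rank (count-unsat p n eq)

  next : ℕ → ℕ
  next n = search n (proj₁ (unbounded n) ∸ n)

  next-spec : ∀ n → T (p (next n)) × count p (next n) ≡ count p n
  next-spec n = search-spec (k ∸ n) n (subst (T ∘ p) (sym (m∸n+n≡m n≤k)) pk)
    where
    k = proj₁ (unbounded n)
    n≤k = proj₁ (proj₂ (unbounded n))
    pk = proj₂ (proj₂ (unbounded n))

  select : ℕ → ℕ
  select zero = next 0
  select (suc i) = next (suc (select i))

  select-sat : ∀ i → T (p (select i))
  select-sat zero = proj₁ (next-spec 0)
  select-sat (suc i) = proj₁ (next-spec (suc (select i)))

  count-select : ∀ i → count p (select i) ≡ i
  count-select zero = proj₂ (next-spec 0)
  count-select (suc i) = begin
    count p (next (suc (select i))) ≡⟨ proj₂ (next-spec (suc (select i))) ⟩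
    count p (suc (select i))        ≡⟨ count-sat p (select i) (select-sat i) ⟩
    suc (count p (select i))        ≡⟨ cong suc (count-select i) ⟩
    suc i                           ∎
    where open ≡-Reasoning

  select-count : ∀ x → T (p x) → select (count p x) ≡ x
  select-count x px = count-injective p (select-sat (count p x)) px (count-select (count p x))

module Halves (p : ℕ → Bool) (sat : Unbounded p) (unsat : Unbounded (not ∘ p)) where
  open Select p sat using (select; select-sat; count-select; select-count)
  open Select (not ∘ p) unsat using ()
    renaming (select to coselect; select-sat to coselect-sat; count-select to count-coselect; select-count to coselect-count)

  to : ℕ → ℕ ⊎ ℕ
  to x = if p x then inj₁ (count p x) else inj₂ (count (not ∘ p) x)

  from : ℕ ⊎ ℕ → ℕ
  from = [ select , coselect ]

  to-sat : ∀ x → T (p x) → to x ≡ inj₁ (count p x)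
  to-sat x px with p x
  ... | true = refl

  to-unsat : ∀ x → T (not (p x)) → to x ≡ inj₂ (count (not ∘ p) x)
  to-unsat x qx with p x
  ... | false = refl

  from-to : ∀ x → from (to x) ≡ x
  from-to x with p x in eq
  ... | true  = select-count x (subst T (sym eq) _)
  ... | false = coselect-count x (subst (T ∘ not) (sym eq) _)

  to-from : ∀ y → to (from y) ≡ y
  to-from (inj₁ i) = trans (to-sat (select i) (select-sat i)) (cong inj₁ (count-select i))
  to-from (inj₂ i) = trans (to-unsat (coselect i) (coselect-sat i)) (cong inj₂ (count-coselect i))

  halves : ℕ ↔ (ℕ ⊎ ℕ)
  halves = mk↔ₛ′ to from to-from from-to

permutation-onto-complement : (b z : ℕ → Bool) →
  Unbounded b → Unbounded (not ∘ b) → Unbounded z → Unbounded (not ∘ z) →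
  Σ (ℕ ↔ ℕ) λ π → ∀ y → T (not (z y)) → Image (Inverse.to π) (T ∘ b) y
permutation-onto-complement b z b-sat b-unsat z-sat z-unsat = π , covers
  where
  module HB = Halves b b-sat b-unsat
  module HZ = Halves z z-sat z-unsat

  π : ℕ ↔ ℕ
  π = ↔-trans HB.halves (↔-trans (⊎-comm ℕ ℕ) (↔-sym HZ.halves))

  -- The preimage of a point outside z is a left-hand element of b's halves.
  covers : ∀ y → T (not (z y)) → Image (Inverse.to π) (T ∘ b) y
  covers y qy = Inverse.from π y , in-b , Inverse.strictlyInverseˡ π y
    where
    in-b : T (b (HB.from (swap (HZ.to y))))
    in-b rewrite HZ.to-unsat y qy = Select.select-sat b b-sat (count (not ∘ z) y)

-- Every infinite set A contains a decidable set which is infinite and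
-- co-infinite: the range of a sequence g in A with g (i+1) ≥ g i + 2,
-- which misses every g i + 1.
module DecidableSubset (A : Subset) (infinite : Infinite A) where

  g : ℕ → ℕ
  g zero = proj₁ (infinite 0)
  g (suc i) = proj₁ (infinite (suc (suc (g i))))

  g-in-A : ∀ i → A (g i)
  g-in-A zero = proj₂ (proj₂ (infinite 0))
  g-in-A (suc i) = proj₂ (proj₂ (infinite (suc (suc (g i)))))

  g-gap : ∀ i → suc (suc (g i)) ≤ g (suc i)
  g-gap i = proj₁ (proj₂ (infinite (suc (suc (g i)))))

  g-mono : ∀ {i j} → i ≤ j → g i ≤ g j
  g-mono = monotone-by-steps g (λ i → ≤-trans (m≤n+m (g i) 2) (g-gap i))

  g-inflationary : ∀ i → i ≤ g i
  g-inflationary zero = z≤n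
  g-inflationary (suc i) = ≤-trans (s≤s (≤-trans (g-inflationary i) (n≤1+n (g i)))) (g-gap i)

  -- Since i ≤ g i, membership in the range only needs the indices i ≤ x.
  inRange : ℕ → Bool
  inRange x = any (λ i → g i ≡ᵇ x) (upTo (suc x))

  inRange-sound : ∀ x → T (inRange x) → ∃ λ i → g i ≡ x
  inRange-sound x found with satisfied (any⁻ _ (upTo (suc x)) found)
  ... | i , gi≡ᵇx = i , ≡ᵇ⇒≡ (g i) x gi≡ᵇx

  inRange-g : ∀ i → T (inRange (g i))
  inRange-g i = any⁺ _ (lose (∈-upTo⁺ (s≤s (g-inflationary i))) (≡⇒≡ᵇ (g i) (g i) refl))

  g-avoids-successors : ∀ i n → g i ≢ suc (g n)
  g-avoids-successors i n gi≡ with i ≤? n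
  ... | yes i≤n = <-irrefl gi≡ (s≤s (g-mono i≤n))
  ... | no  i≰n = <-irrefl (sym gi≡) (≤-trans (g-gap n) (g-mono (≰⇒> i≰n)))

  inRange-unbounded : Unbounded inRange
  inRange-unbounded n = g n , g-inflationary n , inRange-g n

  inRange-counbounded : Unbounded (not ∘ inRange)
  inRange-counbounded n = suc (g n) , m≤n⇒m≤1+n (g-inflationary n) , missed
    where
    missed : T (not (inRange (suc (g n))))
    missed with inRange (suc (g n)) in eq
    ... | true  = let (i , gi≡) = inRange-sound (suc (g n)) (subst T (sym eq) _)
                  in ⊥-elim (g-avoids-successors i n gi≡)
    ... | false = _

  inRange⊆A : ∀ x → T (inRange x) → A x
  inRange⊆A x member = let (i , gi≡x) = inRange-sound x member in subst A gi≡x (g-in-A i)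

-- Squares.  isqrt n = ⌊√n⌋, and sucSquare n says that n + 1 is a perfect
-- square, i.e. that ⌊√⌋ increases from n to n + 1.
mutual
  isqrt : ℕ → ℕ
  isqrt zero = 0
  isqrt (suc n) = if sucSquare n then suc (isqrt n) else isqrt n

  sucSquare : ℕ → Bool
  sucSquare n = suc (isqrt n) * suc (isqrt n) ≤ᵇ suc n

count-sucSquare : ∀ n → count sucSquare n ≡ isqrt n
count-sucSquare zero = refl
count-sucSquare (suc n) with sucSquare n
... | true  = cong suc (count-sucSquare n)
... | false = count-sucSquare n

isqrt-spec : ∀ n → isqrt n * isqrt n ≤ n × n < suc (isqrt n) * suc (isqrt n)
isqrt-spec zero = z≤n , s≤s z≤n
isqrt-spec (suc n) with isqrt-spec n | sucSquare n in eq
... | _ , n<r'² | true = ≤ᵇ⇒≤ (r' * r') (suc n) (subst T (sym eq) _) , ≤-<-trans n<r'² r'²<r''²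
  where
  r' = suc (isqrt n)
  r'²<r''² : r' * r' < suc r' * suc r'
  r'²<r''² = *-mono-< (n<1+n r') (n<1+n r')
... | r²≤n , _ | false = m≤n⇒m≤1+n r²≤n , ≰⇒> λ r'²≤1+n → subst T eq (≤⇒≤ᵇ r'²≤1+n)

isqrt-unique : ∀ {n t} → t * t ≤ n → n < suc t * suc t → isqrt n ≡ t
isqrt-unique {n} {t} t²≤n n<t'² with <-cmp (isqrt n) t | isqrt-spec n
... | tri< r<t _ _ | _ , n<r'² = ⊥-elim (<-irrefl refl (<-≤-trans n<r'² (≤-trans (*-mono-≤ r<t r<t) t²≤n)))
... | tri≈ _ r≡t _ | _         = r≡t
... | tri> _ _ t<r | r²≤n , _  = ⊥-elim (<-irrefl refl (<-≤-trans n<t'² (≤-trans (*-mono-≤ t<r t<r) r²≤n)))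

-- (n+1)² - 1 = n + n(n+1) is a point of sucSquare beyond n.
sucSquare-unbounded : Unbounded sucSquare
sucSquare-unbounded n = k , m≤m+n n _ , subst (λ r → T (suc r * suc r ≤ᵇ suc k)) (sym isqrt-k) (≤⇒≤ᵇ (≤-refl {suc k}))
  where
  k = n + n * suc n
  isqrt-k : isqrt k ≡ n
  isqrt-k = isqrt-unique (≤-trans (*-monoʳ-≤ n (n≤1+n n)) (m≤n+m _ n)) ≤-refl

-- (n+1)² is not a point of sucSquare, as (n+1)² + 1 is no square.
sucSquare-counbounded : Unbounded (not ∘ sucSquare)
sucSquare-counbounded n = k , ≤-trans (n≤1+n n) (m≤m*n (suc n) (suc n)) , not-square
  where
  k = suc n * suc n
  1+k<n''² : suc k < suc (suc n) * suc (suc n)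
  1+k<n''² = s≤s (s≤s (≤-trans (*-monoʳ-≤ (suc n) (n≤1+n (suc n))) (m≤n+m _ n)))
  isqrt-k : isqrt k ≡ suc n
  isqrt-k = isqrt-unique ≤-refl (<-trans (n<1+n k) 1+k<n''²)
  not-square : T (not (sucSquare k))
  not-square with sucSquare k in eq
  ... | true  = ⊥-elim (<-irrefl refl (<-≤-trans 1+k<n''²
                  (subst (λ r → suc r * suc r ≤ suc k) isqrt-k (≤ᵇ⇒≤ _ _ (subst T (sym eq) _)))))
  ... | false = _

-- A predicate has density 0: ρ_n(p) ≤ 1/(k+1) for all large n.
DensityZero : (ℕ → Bool) → Set
DensityZero p = ∀ k → ∃ λ N → ∀ n → N ≤ n → suc k * count p n ≤ n

-- Once n ≥ k(k+1): if √n ≤ k then (k+1)√n ≤ (k+1)k ≤ n, else (k+1)√n ≤ √n² ≤ n.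
sucSquare-density-zero : DensityZero sucSquare
sucSquare-density-zero k = k * suc k , bound
  where
  bound : ∀ n → k * suc k ≤ n → suc k * count sucSquare n ≤ n
  bound n k[k+1]≤n rewrite count-sucSquare n with isqrt n ≤? k
  ... | yes r≤k = ≤-trans (*-monoʳ-≤ (suc k) r≤k) (≤-trans (≤-reflexive (*-comm (suc k) k)) k[k+1]≤n)
  ... | no r≰k  = ≤-trans (*-monoˡ-≤ (isqrt n) (≰⇒> r≰k)) (proj₁ (isqrt-spec n))

complement-proportion : ∀ k n c c' → c + c' ≡ n → suc k * c ≤ n → k * n ≤ suc k * c'
complement-proportion k n c c' c+c'≡n kc≤n = +-cancelʳ-≤ n (k * n) (suc k * c') (begin
  k * n + n             ≡⟨ +-comm (k * n) n ⟩
  suc k * n             ≡⟨ cong (suc k *_) (trans (sym c+c'≡n) (+-comm c c')) ⟩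
  suc k * (c' + c)      ≡⟨ *-distribˡ-+ (suc k) c' c ⟩
  suc k * c' + suc k * c ≤⟨ +-monoʳ-≤ (suc k * c') kc≤n ⟩
  suc k * c' + n        ∎)
  where open ≤-Reasoning

complement-density-one : ∀ p → DensityZero p → HasDensityOne (T ∘ not ∘ p)
complement-density-one p sparse k = N , λ n N≤n →
  members (not ∘ p) n , members-unique (not ∘ p) n , members-below (not ∘ p) n ,
  complement-proportion k n (count p n) (count (not ∘ p) n) (count-complement p n) (bound n N≤n)
  where
  N = proj₁ (sparse k)
  bound = proj₂ (sparse k)

density-at-least-mono : ∀ {S S′ : Subset} → (∀ x → S x → S′ x) → ∀ {k n} →
  DensityAtLeast S k n → DensityAtLeast S′ k n
density-at-least-mono S⊆S′ (L , unique , below , ineq) = L , unique , All.map (map₂ (S⊆S′ _)) below , ineq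

density-one-mono : ∀ {S S′ : Subset} → (∀ x → S x → S′ x) → HasDensityOne S → HasDensityOne S′
density-one-mono S⊆S′ dense k =
  proj₁ (dense k) , λ n N≤n → density-at-least-mono S⊆S′ {k} (proj₂ (dense k) n N≤n)

image-mono : ∀ (f : ℕ → ℕ) {S S′ : Subset} → (∀ x → S x → S′ x) → ∀ y → Image f S y → Image f S′ y
image-mono f S⊆S′ y (a , Sa , fa≡y) = a , S⊆S′ a Sa , fa≡y

mainTheorem5 : (A : Subset) → IsCE A → Infinite A →
    Σ (ℕ ↔ ℕ) λ π → HasDensityOne (Image (Inverse.to π) A)
mainTheorem5 A _ infinite = π , density-one-mono covers nonSquares-dense
  where
  open DecidableSubset A infinite using (inRange; inRange⊆A; inRange-unbounded; inRange-counbounded)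

  permutation : Σ (ℕ ↔ ℕ) λ π → ∀ y → T (not (sucSquare y)) → Image (Inverse.to π) (T ∘ inRange) y
  permutation = permutation-onto-complement inRange sucSquare
    inRange-unbounded inRange-counbounded sucSquare-unbounded sucSquare-counbounded
  π : ℕ ↔ ℕ
  π = proj₁ permutation

  covers : ∀ y → T (not (sucSquare y)) → Image (Inverse.to π) A y
  covers y q = image-mono (Inverse.to π) inRange⊆A y (proj₂ permutation y q)

  nonSquares-dense : HasDensityOne (T ∘ not ∘ sucSquare)
  nonSquares-dense = complement-density-one sucSquare sucSquare-density-zero
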